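{- The property $UN^=$ is decidable for shallow term rewrite systems: there is an algorithm which, given a shallow term rewrite system $R$, decides whether $R$ is $UN^=$.
   Context: Terms are built from a finite signature $\mathcal{F}$ (function symbols with arities; arity-$0$ symbols are constants) and a countably infinite set $X$ of variables disjoint from $\mathcal{F}$. If $t=f(t_1,\dots,t_n)$, the $t_i$ are the depth-1 subterms of $t$. A term $t$ is shallow if every variable occurrence in $t$ is either $t$ itself or a depth-1 subterm of $t$. A rewrite rule is a pair $l\to r$ of terms with $l\notin X$ (variables of $r$ need not occur in $l$); it applies to a term by replacing a subterm of the form $l\sigma$ by $r\sigma$, $\sigma$ a substitution. A term rewrite system (TRS) $R$ is a finite set of rules; it is shallow if both sides of every rule are shallow. $\overset{*}{\leftrightarrow}_R$ denotes the reflexive, symmetric, transitive closure of the one-step rewrite relation of $R$. A normal form is a term none of whose subterms can be rewritten. $R$ is $UN^=$ if there do not exist two distinct normal forms $M,N$ with $M\overset{*}{\leftrightarrow}_R N$. -}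

module Defs where

open import Data.Fin.Base using (Fin)
open import Data.List.Base using (List)
open import Data.List.Membership.Propositional using (_∈_)
open import Data.List.Relation.Unary.All using (All)
open import Data.Nat.Base using (ℕ; zero; suc; _≤_)
open import Data.Product.Base using (∃₂; _×_)
open import Data.Vec.Base using (Vec; []; _∷_; lookup; _[_]≔_)
open import Relation.Binary.Construct.Closure.Equivalence using (EqClosure)
open import Relation.Binary.PropositionalEquality.Core using (_≡_; _≢_)
open import Relation.Binary.Rewriting using (IsNormalForm)
open import Relation.Nullary.Negation.Core using (¬_)

record Signature : Set where
  field
    size  : ℕ
    arity : Fin size → ℕ

  Symbol : Set
  Symbol = Fin size

module _ (F : Signature) where
  open Signature F

  -- The countably infinite set of variables is ℕ.
  data Term : Set where
    var : ℕ → Term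
    app : (f : Symbol) → Vec Term (arity f) → Term

module _ {F : Signature} where
  open Signature F

  Substitution : Set
  Substitution = ℕ → Term F

  mutual
    _⟨_⟩ : Term F → Substitution → Term F
    var x    ⟨ σ ⟩ = σ x
    app f ts ⟨ σ ⟩ = app f (ts ⟨ σ ⟩*)

    _⟨_⟩* : ∀ {n} → Vec (Term F) n → Substitution → Vec (Term F) n
    []       ⟨ σ ⟩* = []
    (t ∷ ts) ⟨ σ ⟩* = t ⟨ σ ⟩ ∷ ts ⟨ σ ⟩*

  -- OccursAt x d t: an occurrence of the variable x at depth d in t.
  data OccursAt (x : ℕ) : ℕ → Term F → Set where
    here  : OccursAt x zero (var x)
    there : ∀ {d f ts} (i : Fin (arity f)) →
            OccursAt x d (lookup ts i) → OccursAt x (suc d) (app f ts)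

  -- An occurrence at depth 0 is t itself; one at depth 1 is one of the
  -- depth-1 subterms of t.
  ShallowTerm : Term F → Set
  ShallowTerm t = ∀ {x d} → OccursAt x d t → d ≤ 1

-- Variables of rhs need not occur in lhs.
record Rule (F : Signature) : Set where
  field
    lhs      : Term F
    rhs      : Term F
    lhs-¬var : ∀ x → lhs ≢ var x

open Rule public

TRS : Signature → Set
TRS F = List (Rule F)

module _ {F : Signature} where
  open Signature F

  ShallowRule : Rule F → Set
  ShallowRule ρ = ShallowTerm (lhs ρ) × ShallowTerm (rhs ρ)

  Shallow : TRS F → Set
  Shallow = All ShallowRule

  data Step (R : TRS F) : Term F → Term F → Set where
    root : ∀ {ρ} → ρ ∈ R → (σ : Substitution) →
           Step R (lhs ρ ⟨ σ ⟩) (rhs ρ ⟨ σ ⟩)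
    arg  : ∀ {f ts u} (i : Fin (arity f)) → Step R (lookup ts i) u →
           Step R (app f ts) (app f (ts [ i ]≔ u))

  -- Step R rewrites at arbitrary positions, so IsNormalForm (Step R) t says
  -- that no subterm of t is an instance of a left-hand side.
  UN⁼ : TRS F → Set
  UN⁼ R = ¬ ∃₂ λ M N →
    IsNormalForm (Step R) M × IsNormalForm (Step R) N ×
    M ≢ N × EqClosure (Step R) M N

-- In a shallow rule every argument of a side is a variable or a ground term, so
-- R becomes a flat equational theory ∼ over the finite set Ks of these ground
-- terms and arbitrarily many free constants. Derivations between flat terms can
-- be renamed into finitely many constants, hence ∼ is decidable. Conversely, any
-- map θ from flat terms to constants that respects ∼ and fixes constants is a
-- model of R.
--
-- Saturation yields a table of ground normal forms, with one for every constant
-- of Ks that is reachable from normal forms. The table gives values to flat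
-- terms. If two ∼-equivalent flat terms over Ks and boundedly many variables have
-- different normal forms as values, R is not UN⁼. Otherwise equivalent flat terms
-- never have different values, so for normal forms M and N one can choose θ such
-- that every subterm t of M or N evaluates to its own constant: the k in Ks whose
-- table entry is t, or else a free constant named t. Since M ↔* N forces equal
-- evaluations, M and N coincide.
module Submission where

open import Defs
open import Relation.Nullary.Decidable.Core using (Dec)

open import Data.Fin.Base using (Fin; zero; suc)
open import Data.Fin.Properties as Fin using ()
open import Data.List.Base as List using (List; []; _∷_; _++_; concatMap; cartesianProduct; length; upTo; allFin)
open import Data.List.Membership.Propositional using (_∈_; find; lose)
open import Data.List.Membership.Propositional.Properties
  using (∈-map⁺; ∈-map⁻; ∈-++⁺ˡ; ∈-++⁺ʳ; ∈-++⁻; ∈-concatMap⁺; ∈-concatMap⁻; ∈-cartesianProduct⁺;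
         ∈-cartesianProductWith⁺; ∈-allFin; ∈-upTo⁺; ∈-filter⁺; ∈-filter⁻)
import Data.List.Membership.DecPropositional as DecMembership
open import Data.List.Properties using (length-removeAt′; length-++)
open import Data.List.Relation.Unary.All as All using (All)
open import Data.List.Relation.Unary.Any as Any using (Any; here; there; any?; _─_)
open import Data.Maybe.Base using (Maybe; just; nothing)
open import Data.Maybe.Properties using (just-injective)
open import Data.Nat.Base using (ℕ; zero; suc; _+_; _≤_; _∸_; _<_; z≤n; s≤s; z<s; s<s)
open import Data.Nat.ListAction using (sum)
open import Data.Nat.Properties as ℕ using ()
open import Data.Product.Base using (∃; ∃₂; _×_; _,_; proj₁; proj₂)
open import Data.Product.Properties using (≡-dec)
open import Data.Sum.Base using (_⊎_; inj₁; inj₂; [_,_]′)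
open import Data.Vec.Base using (Vec; []; _∷_; lookup; map; tabulate; toList; _[_]≔_)
open import Data.Vec.Properties
  using (lookup-map; lookup∘tabulate; lookup∘update; lookup∘update′; []≔-idempotent; length-toList)
  renaming (≡-dec to ≡-decᵛ)
open import Function.Base using (_∘_; id; const)
open import Relation.Binary.Construct.Closure.Equivalence as EqClosure using (EqClosure)
open import Relation.Binary.Definitions using (DecidableEquality)
open import Relation.Binary.PropositionalEquality.Core using (_≡_; _≢_; refl; sym; trans; cong; cong₂; subst; subst₂)
open import Relation.Binary.Rewriting using (IsNormalForm)
open import Relation.Binary.Structures using (IsEquivalence)
open import Relation.Nullary.Decidable.Core using (yes; no; map′; _×-dec_; _⊎-dec_; ¬?)
open import Relation.Nullary.Negation.Core using (¬_; contradiction)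

-- Vectors, finite lists and bounded search.

vec-ext : ∀ {A : Set} {n} {xs ys : Vec A n} → (∀ i → lookup xs i ≡ lookup ys i) → xs ≡ ys
vec-ext {xs = []}     {[]}     p = refl
vec-ext {xs = x ∷ xs} {y ∷ ys} p = cong₂ _∷_ (p zero) (vec-ext (p ∘ suc))

lookup∈toList : ∀ {A : Set} {n} (xs : Vec A n) i → lookup xs i ∈ toList xs
lookup∈toList (x ∷ xs) zero    = here refl
lookup∈toList (x ∷ xs) (suc i) = there (lookup∈toList xs i)

∈toList⇒lookup : ∀ {A : Set} {n} (xs : Vec A n) {x} → x ∈ toList xs → ∃ λ i → x ≡ lookup xs i
∈toList⇒lookup (x ∷ xs) (here refl) = zero , refl
∈toList⇒lookup (x ∷ xs) (there x∈) with i , eq ← ∈toList⇒lookup xs x∈ = suc i , eq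

vecs : ∀ {A : Set} → List A → ∀ n → List (Vec A n)
vecs xs zero    = [] ∷ []
vecs xs (suc n) = List.cartesianProductWith _∷_ xs (vecs xs n)

∈-vecs : ∀ {A : Set} {xs : List A} {n} (v : Vec A n) → (∀ i → lookup v i ∈ xs) → v ∈ vecs xs n
∈-vecs []      p = here refl
∈-vecs (x ∷ v) p = ∈-cartesianProductWith⁺ _∷_ (p zero) (∈-vecs v (p ∘ suc))

any∈? : ∀ {A : Set} {P : A → Set} xs → (∀ {x} → x ∈ xs → Dec (P x)) → Dec (Any P xs)
any∈? []       P? = no λ ()
any∈? (x ∷ xs) P? = map′ Any.fromSum Any.toSum (P? (here refl) ⊎-dec any∈? xs (P? ∘ there))

∈-sum : ∀ {A : Set} (f : A → ℕ) {x xs} → x ∈ xs → f x ≤ sum (List.map f xs)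
∈-sum f (here refl)        = ℕ.m≤m+n _ _
∈-sum f {xs = y ∷ _} (there x∈) = ℕ.≤-trans (∈-sum f x∈) (ℕ.m≤n+m _ (f y))

─-split : ∀ {A : Set} {P : A → Set} {x xs} (p : Any P xs) → x ∈ xs → x ≡ proj₁ (Any.satisfied p) ⊎ x ∈ (xs ─ p)
─-split (here px) (here refl) = inj₁ refl
─-split (here px) (there x∈)  = inj₂ x∈
─-split {xs = _ ∷ _ ∷ _} (there p) (here refl) = inj₂ (here refl)
─-split {xs = _ ∷ _ ∷ _} (there p) (there x∈) with ─-split p x∈
... | inj₁ eq = inj₁ eq
... | inj₂ q  = inj₂ (there q)

-- A fired goal leaves the list of goals, so forward chaining stops.
module Saturation
  {X Y : Set} (key : Y → X)
  (Fire : List Y → X → Set) (fire? : ∀ S x → Dec (Fire S x))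
  (result : ∀ {S x} → Fire S x → Y) (key-result : ∀ {S x} (p : Fire S x) → key (result p) ≡ x)
  (Inv : List Y → Set) (inv-result : ∀ {S x} (p : Fire S x) → Inv S → Inv (result p ∷ S))
  where

  -- `Fire` is judged against the final list `S`, so premises that arrive late in the process are
  -- taken into account.
  Saturated : List X → List Y → Set
  Saturated xs S = ∀ {x} → x ∈ xs → (∃ λ y → y ∈ S × key y ≡ x) ⊎ ¬ Fire S x

  saturateFrom : ∀ n xs S → length xs ≡ n → Inv S → ∃ λ T → (∀ {y} → y ∈ S → y ∈ T) × Inv T × Saturated xs T
  saturateFrom n xs S len inv with any? (fire? S) xs
  ... | no ¬p = S , id , inv , λ x∈ → inj₂ λ q → ¬p (lose x∈ q)
  saturateFrom zero    [] S len inv | yes ()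
  saturateFrom (suc n) xs S len inv | yes p
    with T , S⊆T , invT , satT ← saturateFrom n (xs ─ p) (result (proj₂ (Any.satisfied p)) ∷ S)
           (ℕ.suc-injective (trans (sym (length-removeAt′ xs (Any.index p))) len))
           (inv-result (proj₂ (Any.satisfied p)) inv)
    = T , S⊆T ∘ there , invT , λ x∈ → sat (─-split p x∈)
    where
    sat : ∀ {x} → x ≡ proj₁ (Any.satisfied p) ⊎ x ∈ (xs ─ p) → (∃ λ y → y ∈ T × key y ≡ x) ⊎ ¬ Fire T x
    sat (inj₁ refl) = inj₁ (_ , S⊆T (here refl) , key-result (proj₂ (Any.satisfied p)))
    sat (inj₂ x∈)   = satT x∈

  saturate : ∀ xs → Inv [] → ∃ λ T → Inv T × Saturated xs T
  saturate xs inv with T , _ , rest ← saturateFrom (length xs) xs [] refl inv = T , rest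

-- Terms, substitutions and subterms.

module _ {F : Signature} where
  open Signature F

  term-ind : (P : Term F → Set) → (∀ x → P (var x)) →
             (∀ f ts → (∀ i → P (lookup ts i)) → P (app f ts)) → ∀ t → P t
  term-ind P v a = ind
    where
    ind  : ∀ t → P t
    ind* : ∀ {n} (ts : Vec (Term F) n) i → P (lookup ts i)
    ind (var x)    = v x
    ind (app f ts) = a f ts (ind* ts)
    ind* (t ∷ ts) zero    = ind t
    ind* (t ∷ ts) (suc i) = ind* ts i

  infix 4 _≟ₜ_ _≟ₜₛ_

  _≟ₜ_  : DecidableEquality (Term F)
  _≟ₜₛ_ : ∀ {n} → DecidableEquality (Vec (Term F) n)
  var x    ≟ₜ var y    = map′ (cong var) (λ { refl → refl }) (x ℕ.≟ y)
  var x    ≟ₜ app g us = no λ ()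
  app f ts ≟ₜ var y    = no λ ()
  app f ts ≟ₜ app g us with f Fin.≟ g
  ... | no f≢g   = no λ { refl → f≢g refl }
  ... | yes refl = map′ (cong (app f)) (λ { refl → refl }) (ts ≟ₜₛ us)
  []       ≟ₜₛ []       = yes refl
  (t ∷ ts) ≟ₜₛ (u ∷ us) = map′ (λ (p , q) → cong₂ _∷_ p q) (λ { refl → refl , refl }) (t ≟ₜ u ×-dec ts ≟ₜₛ us)

  lookup-⟨⟩* : ∀ {n} (ts : Vec (Term F) n) σ i → lookup (ts ⟨ σ ⟩*) i ≡ lookup ts i ⟨ σ ⟩
  lookup-⟨⟩* (t ∷ ts) σ zero    = refl
  lookup-⟨⟩* (t ∷ ts) σ (suc i) = lookup-⟨⟩* ts σ i

  ⟨⟩*-cong : ∀ {n} (ts us : Vec (Term F) n) {σ τ} →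
             (∀ i → lookup ts i ⟨ σ ⟩ ≡ lookup us i ⟨ τ ⟩) → ts ⟨ σ ⟩* ≡ us ⟨ τ ⟩*
  ⟨⟩*-cong ts us p = vec-ext λ i → trans (lookup-⟨⟩* ts _ i) (trans (p i) (sym (lookup-⟨⟩* us _ i)))

  ⟨⟩*-intro : ∀ {n} (ts : Vec (Term F) n) {us σ} →
              (∀ i → lookup ts i ⟨ σ ⟩ ≡ lookup us i) → ts ⟨ σ ⟩* ≡ us
  ⟨⟩*-intro ts p = vec-ext λ i → trans (lookup-⟨⟩* ts _ i) (p i)

  ⟨⟩-∘ : ∀ (σ τ : Substitution) t → t ⟨ σ ⟩ ⟨ τ ⟩ ≡ t ⟨ (λ x → σ x ⟨ τ ⟩) ⟩
  ⟨⟩-∘ σ τ = term-ind _ (λ x → refl) λ f ts ih →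
    cong (app f) (⟨⟩*-cong (ts ⟨ σ ⟩*) ts λ i → trans (cong (_⟨ τ ⟩) (lookup-⟨⟩* ts σ i)) (ih i))

  -- An equality would make the argument at `i` equal to its own argument at `i`, so structural
  -- induction rules it out.
  app≢lookup : ∀ f ts i → app f ts ≢ lookup ts i
  app≢lookup f ts i = term-ind (λ t → ∀ f ts i → t ≡ app f ts → app f ts ≢ lookup ts i)
    (λ x f ts i ()) (λ { f ts ih f ts i refl eq → ih i f ts i (sym eq) eq }) (app f ts) f ts i refl

  subterms  : Term F → List (Term F)
  subterms* : ∀ {n} → Vec (Term F) n → List (Term F)
  subterms (var x)    = var x ∷ []
  subterms (app f ts) = app f ts ∷ subterms* ts
  subterms* []       = []
  subterms* (t ∷ ts) = subterms t ++ subterms* ts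

  ∈-subterms : ∀ t → t ∈ subterms t
  ∈-subterms (var x)    = here refl
  ∈-subterms (app f ts) = here refl

  ∈-subterms*⁺ : ∀ {n} (ts : Vec (Term F) n) i {u} → u ∈ subterms (lookup ts i) → u ∈ subterms* ts
  ∈-subterms*⁺ (t ∷ ts) zero    u∈ = ∈-++⁺ˡ u∈
  ∈-subterms*⁺ (t ∷ ts) (suc i) u∈ = ∈-++⁺ʳ (subterms t) (∈-subterms*⁺ ts i u∈)

  ∈-subterms*⁻ : ∀ {n} (ts : Vec (Term F) n) {u} → u ∈ subterms* ts → ∃ λ i → u ∈ subterms (lookup ts i)
  ∈-subterms*⁻ (t ∷ ts) u∈ with ∈-++⁻ (subterms t) u∈
  ... | inj₁ u∈t = zero , u∈t
  ... | inj₂ u∈ts with i , u∈ti ← ∈-subterms*⁻ ts u∈ts = suc i , u∈ti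

  subterms-closed : ∀ t {f us} → app f us ∈ subterms t → ∀ i → lookup us i ∈ subterms t
  subterms-closed = term-ind _ (λ { x (here ()) })
    λ { f ts ih (here refl) i → there (∈-subterms*⁺ ts i (∈-subterms (lookup ts i)))
      ; f ts ih (there u∈) i → let j , u∈j = ∈-subterms*⁻ ts u∈ in there (∈-subterms*⁺ ts j (ih j u∈j i)) }

  subterms-ind : (P : Term F → Set) → (∀ {f ts} → P (app f ts) → ∀ i → P (lookup ts i)) →
                 ∀ t → P t → ∀ {u} → u ∈ subterms t → P u
  subterms-ind P down = term-ind _ (λ { x p (here refl) → p })
    λ { f ts ih p (here refl) → p
      ; f ts ih p (there u∈) → let j , u∈j = ∈-subterms*⁻ ts u∈ in ih j (down p j) u∈j }

-- The flat equational theory of the rules.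

module Flattening
  {F : Signature} (R : TRS F) (Ks : List (Term F))
  (Ks-app : ∀ {k} → k ∈ Ks → ∃₂ λ f ts → k ≡ app f ts)
  (Ks-closed : ∀ {f ts} → app f ts ∈ Ks → ∀ i → lookup ts i ∈ Ks)
  where
  open Signature F

  data Arg : Term F → Set where
    var : ∀ {x} → Arg (var x)
    con : ∀ {k} → k ∈ Ks → Arg k

  data Side : Term F → Set where
    var : ∀ {x} → Side (var x)
    app : ∀ {f ts} → (∀ i → Arg (lookup ts i)) → Side (app f ts)

  Ks-ground : ∀ t → t ∈ Ks → ∀ σ → t ⟨ σ ⟩ ≡ t
  Ks-ground = term-ind _ (λ x x∈ → contradiction (proj₂ (proj₂ (Ks-app x∈))) λ ())
    λ f ts ih t∈ σ → cong (app f) (⟨⟩*-intro ts λ i → ih i (Ks-closed t∈ i) σ)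

  -- Flat terms over the constants of Ks and further free constants. Every
  -- term t is also available as a free constant gen t.
  data Const : Set where
    kon gen : Term F → Const

  genVar : ℕ → Const
  genVar x = gen (var x)

  data Flat : Set where
    elem : Const → Flat
    node : (f : Symbol) → Vec Const (arity f) → Flat

  kons : List Const
  kons = List.map kon Ks

  -- Every application is read as a constant of `Ks`, which is right for arguments satisfying `Arg`.
  konArg : (ℕ → Const) → Term F → Const
  konArg σ (var x)      = σ x
  konArg σ k@(app f ts) = kon k

  flatten : (ℕ → Const) → Term F → Flat
  flatten σ (var x)    = elem (σ x)
  flatten σ (app f ts) = node f (map (konArg σ) ts)

  unfold : Term F → Flat
  unfold (var x)    = elem (kon (var x))
  unfold (app f ts) = node f (map kon ts)

  konArg-con : ∀ {σ k} → k ∈ Ks → konArg σ k ≡ kon k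
  konArg-con k∈ with _ , _ , refl ← Ks-app k∈ = refl

  infix 4 _∼_ _≈_

  -- Rule variables range over constants only, so every term of a derivation is flat. `∼-con` ties
  -- the constant of a ground term to the flat term that it abbreviates.
  data _∼_ : Flat → Flat → Set where
    ∼-refl  : ∀ {s} → s ∼ s
    ∼-sym   : ∀ {s t} → s ∼ t → t ∼ s
    ∼-trans : ∀ {s t u} → s ∼ t → t ∼ u → s ∼ u
    ∼-cong  : ∀ {f cs ds} → (∀ i → elem (lookup cs i) ∼ elem (lookup ds i)) → node f cs ∼ node f ds
    ∼-con   : ∀ {k} → k ∈ Ks → elem (kon k) ∼ unfold k
    ∼-rule  : ∀ {ρ} → ρ ∈ R → ∀ σ → flatten σ (lhs ρ) ∼ flatten σ (rhs ρ)

  ∼-isEquivalence : IsEquivalence _∼_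
  ∼-isEquivalence = record { refl = ∼-refl ; sym = ∼-sym ; trans = ∼-trans }

  ≡⇒∼ : ∀ {s t} → s ≡ t → s ∼ t
  ≡⇒∼ refl = ∼-refl

  _≈_ : Term F → Term F → Set
  _≈_ = EqClosure (Step R)

  open IsEquivalence (EqClosure.isEquivalence (Step R)) public
    using () renaming (refl to ≈-refl; sym to ≈-sym; trans to ≈-trans)

  ≈-arg : ∀ {f ts i s u} → s ≈ u → app f (ts [ i ]≔ s) ≈ app f (ts [ i ]≔ u)
  ≈-arg {f} {ts} {i} = EqClosure.gmap (λ s → app f (ts [ i ]≔ s)) λ {s} {u} s→u →
    subst (λ us → Step R (app f (ts [ i ]≔ s)) (app f us)) ([]≔-idempotent ts i)
      (arg i (subst (λ v → Step R v u) (sym (lookup∘update i ts s)) s→u))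

  -- The context `C` is arbitrary so that, once the head has been replaced, it can be absorbed into
  -- the context of the tail.
  ≈-pointwise : ∀ {n} (C : Vec (Term F) n → Term F) →
                (∀ ts i {s u} → s ≈ u → C (ts [ i ]≔ s) ≈ C (ts [ i ]≔ u)) →
                ∀ ts us → (∀ i → lookup ts i ≈ lookup us i) → C ts ≈ C us
  ≈-pointwise C h []       []       p = ≈-refl
  ≈-pointwise C h (t ∷ ts) (u ∷ us) p = ≈-trans (h (t ∷ ts) zero (p zero))
    (≈-pointwise (C ∘ (u ∷_)) (λ ts i → h (u ∷ ts) (suc i)) ts us (p ∘ suc))

  ≈-cong : ∀ {f} ts us → (∀ i → lookup ts i ≈ lookup us i) → app f ts ≈ app f us
  ≈-cong {f} = ≈-pointwise (app f) λ ts i → ≈-arg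

  ⌊_⌋ᶜ : Const → Term F
  ⌊ kon t ⌋ᶜ = t
  ⌊ gen t ⌋ᶜ = t

  ⌊_⌋ : Flat → Term F
  ⌊ elem c ⌋    = ⌊ c ⌋ᶜ
  ⌊ node f cs ⌋ = app f (map ⌊_⌋ᶜ cs)

  ⌊unfold⌋ : ∀ k → ⌊ unfold k ⌋ ≡ k
  ⌊unfold⌋ (var x)    = refl
  ⌊unfold⌋ (app f ts) = cong (app f) (vec-ext λ i → trans (lookup-map i ⌊_⌋ᶜ (map kon ts)) (cong ⌊_⌋ᶜ (lookup-map i kon ts)))

  ⌊konArg⌋ : ∀ σ {t} → Arg t → ⌊ konArg σ t ⌋ᶜ ≡ t ⟨ ⌊_⌋ᶜ ∘ σ ⟩
  ⌊konArg⌋ σ var      = refl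
  ⌊konArg⌋ σ (con k∈) = trans (cong ⌊_⌋ᶜ (konArg-con k∈)) (sym (Ks-ground _ k∈ _))

  ⌊flatten⌋ : ∀ σ {t} → Side t → ⌊ flatten σ t ⌋ ≡ t ⟨ ⌊_⌋ᶜ ∘ σ ⟩
  ⌊flatten⌋ σ var = refl
  ⌊flatten⌋ σ (app {f} {ts} args) = cong (app f) (sym (⟨⟩*-intro ts λ i →
    trans (sym (⌊konArg⌋ σ (args i)))
          (sym (trans (lookup-map i ⌊_⌋ᶜ (map (konArg σ) ts)) (cong ⌊_⌋ᶜ (lookup-map i (konArg σ) ts))))))

  rename : (Const → Const) → Flat → Flat
  rename ρ (elem c)    = elem (ρ c)
  rename ρ (node f cs) = node f (map ρ cs)

  FixesKs : (Const → Const) → Set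
  FixesKs ρ = ∀ {k} → k ∈ Ks → ρ (kon k) ≡ kon k

  rename-unfold : ∀ ρ → FixesKs ρ → ∀ {k} → k ∈ Ks → rename ρ (unfold k) ≡ unfold k
  rename-unfold ρ fix {app f ts} k∈ = cong (node f) (vec-ext λ i →
    trans (lookup-map i ρ (map kon ts)) (trans (cong ρ (lookup-map i kon ts))
      (trans (fix (Ks-closed k∈ i)) (sym (lookup-map i kon ts)))))
  rename-unfold ρ fix {var x} k∈ = cong elem (fix k∈)

  rename-konArg : ∀ ρ → FixesKs ρ → ∀ σ {t} → Arg t → ρ (konArg σ t) ≡ konArg (ρ ∘ σ) t
  rename-konArg ρ fix σ var = refl
  rename-konArg ρ fix σ (con k∈) =
    trans (cong ρ (konArg-con k∈)) (trans (fix k∈) (sym (konArg-con k∈)))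

  rename-flatten : ∀ ρ → FixesKs ρ → ∀ σ {t} → Side t → rename ρ (flatten σ t) ≡ flatten (ρ ∘ σ) t
  rename-flatten ρ fix σ var = refl
  rename-flatten ρ fix σ (app {f} {ts} args) = cong (node f) (vec-ext λ i →
    trans (lookup-map i ρ (map (konArg σ) ts)) (trans (cong ρ (lookup-map i (konArg σ) ts))
      (trans (rename-konArg ρ fix σ (args i)) (sym (lookup-map i (konArg (ρ ∘ σ)) ts)))))

  Over : (Const → Set) → Flat → Set
  Over P (elem c)    = P c
  Over P (node f cs) = ∀ i → P (lookup cs i)

  Over-map : ∀ {P Q : Const → Set} → (∀ {c} → P c → Q c) → ∀ s → Over P s → Over Q s
  Over-map h (elem c)    p   = h p
  Over-map h (node f cs) p i = h (p i)

  Over-rename : ∀ {P : Const → Set} ρ s → Over (P ∘ ρ) s → Over P (rename ρ s)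
  Over-rename ρ (elem c) p = p
  Over-rename {P} ρ (node f cs) p i = subst P (sym (lookup-map i ρ cs)) (p i)

  rename-id : ∀ {ρ} s → Over (λ c → ρ c ≡ c) s → rename ρ s ≡ s
  rename-id (elem c) p = cong elem p
  rename-id {ρ} (node f cs) p = cong (node f) (vec-ext λ i → trans (lookup-map i ρ cs) (p i))

  consts : Flat → List Const
  consts (elem c)    = c ∷ []
  consts (node f cs) = toList cs

  Over-consts : ∀ s → Over (_∈ consts s) s
  Over-consts (elem c)    = here refl
  Over-consts (node f cs) = lookup∈toList cs

  infix 4 _≟ᶜ_ _≟ᶠ_ _∈ᶜ?_

  _≟ᶜ_ : DecidableEquality Const
  kon t ≟ᶜ kon u = map′ (cong kon) (λ { refl → refl }) (t ≟ₜ u)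
  kon t ≟ᶜ gen u = no λ ()
  gen t ≟ᶜ kon u = no λ ()
  gen t ≟ᶜ gen u = map′ (cong gen) (λ { refl → refl }) (t ≟ₜ u)

  _∈ᶜ?_ : ∀ c cs → Dec (c ∈ cs)
  _∈ᶜ?_ = DecMembership._∈?_ _≟ᶜ_

  _≟ᶠ_ : DecidableEquality Flat
  elem c    ≟ᶠ elem d    = map′ (cong elem) (λ { refl → refl }) (c ≟ᶜ d)
  elem c    ≟ᶠ node g ds = no λ ()
  node f cs ≟ᶠ elem d    = no λ ()
  node f cs ≟ᶠ node g ds with f Fin.≟ g
  ... | no f≢g   = no λ { refl → f≢g refl }
  ... | yes refl = map′ (cong (node f)) (λ { refl → refl }) (≡-decᵛ _≟ᶜ_ cs ds)

  -- Soundness and renaming of flat derivations.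

  module Rules (sides : ∀ {ρ} → ρ ∈ R → Side (lhs ρ) × Side (rhs ρ)) where

    -- Reading constants back as terms turns `∼-con` into an identity and `∼-rule` into a root step
    -- under the substitution `⌊_⌋ᶜ ∘ σ`.
    sound : ∀ {s t} → s ∼ t → ⌊ s ⌋ ≈ ⌊ t ⌋
    sound ∼-refl        = ≈-refl
    sound (∼-sym p)     = ≈-sym (sound p)
    sound (∼-trans p q) = ≈-trans (sound p) (sound q)
    sound (∼-cong {f} {cs} {ds} p) = ≈-cong (map ⌊_⌋ᶜ cs) (map ⌊_⌋ᶜ ds) λ i →
      subst₂ _≈_ (sym (lookup-map i ⌊_⌋ᶜ cs)) (sym (lookup-map i ⌊_⌋ᶜ ds)) (sound (p i))
    sound (∼-con {k} k∈) = subst (k ≈_) (sym (⌊unfold⌋ k)) ≈-refl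
    sound (∼-rule {ρ} ρ∈ σ) =
      subst₂ _≈_ (sym (⌊flatten⌋ σ (proj₁ (sides ρ∈)))) (sym (⌊flatten⌋ σ (proj₂ (sides ρ∈))))
        (EqClosure.return (root ρ∈ (⌊_⌋ᶜ ∘ σ)))

    -- The theory singles out only the constants of `Ks`. All others behave like variables and may
    -- be replaced or even merged; the renaming arguments below rest on this.
    rename-∼ : ∀ ρ → FixesKs ρ → ∀ {s t} → s ∼ t → rename ρ s ∼ rename ρ t
    rename-∼ ρ fix ∼-refl        = ∼-refl
    rename-∼ ρ fix (∼-sym p)     = ∼-sym (rename-∼ ρ fix p)
    rename-∼ ρ fix (∼-trans p q) = ∼-trans (rename-∼ ρ fix p) (rename-∼ ρ fix q)
    rename-∼ ρ fix (∼-cong {f} {cs} {ds} p) = ∼-cong λ i →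
      subst₂ (λ c d → elem c ∼ elem d) (sym (lookup-map i ρ cs)) (sym (lookup-map i ρ ds)) (rename-∼ ρ fix (p i))
    rename-∼ ρ fix (∼-con k∈) =
      subst₂ _∼_ (cong elem (sym (fix k∈))) (sym (rename-unfold ρ fix k∈)) (∼-con k∈)
    rename-∼ τ fix (∼-rule ρ∈ σ) =
      subst₂ _∼_ (sym (rename-flatten τ fix σ (proj₁ (sides ρ∈)))) (sym (rename-flatten τ fix σ (proj₂ (sides ρ∈))))
        (∼-rule ρ∈ (τ ∘ σ))

    argVars : Term F → List ℕ
    argVars (var x)    = x ∷ []
    argVars (app f ts) = []

    sideVars : Term F → List ℕ
    sideVars (var x)    = x ∷ []
    sideVars (app f ts) = concatMap argVars (toList ts)

    flatten-agree : ∀ {σ τ} t → (∀ {x} → x ∈ sideVars t → σ x ≡ τ x) → flatten σ t ≡ flatten τ t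
    flatten-agree (var x) agree = cong elem (agree (here refl))
    flatten-agree {σ} {τ} (app f ts) agree = cong (node f) (vec-ext λ i →
      trans (lookup-map i (konArg σ) ts) (trans
        (konArg-agree (lookup ts i) λ x∈ → agree (∈-concatMap⁺ argVars (lose (lookup∈toList ts i) x∈)))
        (sym (lookup-map i (konArg τ) ts))))
      where
      konArg-agree : ∀ t → (∀ {x} → x ∈ argVars t → σ x ≡ τ x) → konArg σ t ≡ konArg τ t
      konArg-agree (var x)    agree = agree (here refl)
      konArg-agree (app f ts) agree = refl

    ruleVars : Rule F → List ℕ
    ruleVars ρ = sideVars (lhs ρ) ++ sideVars (rhs ρ)

    -- Deciding flat equivalence by saturation.

    module Finite (L : List Const) where

      update : ℕ → Const → (ℕ → Const) → ℕ → Const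
      update x c σ y with y ℕ.≟ x
      ... | yes _ = c
      ... | no  _ = σ y

      -- One representative for each way of giving the listed variables values in `L`. Elsewhere the
      -- value is the arbitrary `genVar`, which is harmless by `flatten-agree`.
      assignments : List ℕ → List (ℕ → Const)
      assignments []       = genVar ∷ []
      assignments (x ∷ xs) = List.cartesianProductWith (update x) L (assignments xs)

      ∈-assignments : (σ : ℕ → Const) → (∀ x → σ x ∈ L) → ∀ xs →
                      ∃ λ τ → τ ∈ assignments xs × (∀ {x} → x ∈ xs → σ x ≡ τ x)
      ∈-assignments σ σ∈ [] = _ , here refl , λ ()
      ∈-assignments σ σ∈ (x ∷ xs) with τ , τ∈ , agree ← ∈-assignments σ σ∈ xs =
        update x (σ x) τ , ∈-cartesianProductWith⁺ (update x) (σ∈ x) τ∈ , agree′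
        where
        agree′ : ∀ {y} → y ∈ x ∷ xs → σ y ≡ update x (σ x) τ y
        agree′ {y} y∈ with y ℕ.≟ x
        agree′ y∈         | yes refl = refl
        agree′ (here y≡x) | no y≢x   = contradiction y≡x y≢x
        agree′ (there y∈) | no _     = agree y∈

      flats : List Flat
      flats = List.map elem L ++ concatMap (λ f → List.map (node f) (vecs L (arity f))) (allFin size)

      ∈-flats : ∀ s → Over (_∈ L) s → s ∈ flats
      ∈-flats (elem c)    c∈  = ∈-++⁺ˡ (∈-map⁺ elem c∈)
      ∈-flats (node f cs) cs∈ = ∈-++⁺ʳ (List.map elem L)
        (∈-concatMap⁺ _ (lose (∈-allFin f) (∈-map⁺ (node f) (∈-vecs cs cs∈))))

      Congruent : List (Flat × Flat) → Flat → Flat → Set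
      Congruent A s t = ∃ λ f → Any (λ cs → Any (λ ds → s ≡ node f cs × t ≡ node f ds ×
        (∀ i → (elem (lookup cs i) , elem (lookup ds i)) ∈ A)) (vecs L (arity f))) (vecs L (arity f))

      RuleInstance : Flat → Flat → Set
      RuleInstance s t = Any (λ ρ → Any (λ σ → s ≡ flatten σ (lhs ρ) × t ≡ flatten σ (rhs ρ)) (assignments (ruleVars ρ))) R

      -- Mirrors the constructors of `_∼_`, with premises looked up in `A` and with intermediate
      -- terms, constants and assignments drawn from finite lists, which makes it decidable.
      Consequence : List (Flat × Flat) → Flat × Flat → Set
      Consequence A (s , t) =
        s ≡ t ⊎
        (t , s) ∈ A ⊎
        Any (λ u → (s , u) ∈ A × (u , t) ∈ A) flats ⊎
        Congruent A s t ⊎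
        Any (λ k → s ≡ elem (kon k) × t ≡ unfold k) Ks ⊎
        RuleInstance s t

      consequence? : ∀ A e → Dec (Consequence A e)
      consequence? A (s , t) =
        s ≟ᶠ t ⊎-dec
        (t , s) ∈? A ⊎-dec
        any? (λ u → (s , u) ∈? A ×-dec (u , t) ∈? A) flats ⊎-dec
        Fin.any? (λ f → any? (λ cs → any? (λ ds → s ≟ᶠ node f cs ×-dec t ≟ᶠ node f ds ×-dec
          Fin.all? (λ i → (elem (lookup cs i) , elem (lookup ds i)) ∈? A)) (vecs L (arity f))) (vecs L (arity f))) ⊎-dec
        any? (λ k → s ≟ᶠ elem (kon k) ×-dec t ≟ᶠ unfold k) Ks ⊎-dec
        any? (λ ρ → any? (λ σ → s ≟ᶠ flatten σ (lhs ρ) ×-dec t ≟ᶠ flatten σ (rhs ρ)) (assignments (ruleVars ρ))) R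
        where open DecMembership (≡-dec _≟ᶠ_ _≟ᶠ_) using (_∈?_)

      Sound : List (Flat × Flat) → Set
      Sound A = ∀ {s t} → (s , t) ∈ A → s ∼ t

      consequence-sound : ∀ {A s t} → Sound A → Consequence A (s , t) → s ∼ t
      consequence-sound snd (inj₁ refl) = ∼-refl
      consequence-sound snd (inj₂ (inj₁ p)) = ∼-sym (snd p)
      consequence-sound snd (inj₂ (inj₂ (inj₁ p))) with _ , q , r ← Any.satisfied p = ∼-trans (snd q) (snd r)
      consequence-sound snd (inj₂ (inj₂ (inj₂ (inj₁ (f , p)))))
        with _ , q ← Any.satisfied p
        with _ , refl , refl , r ← Any.satisfied q = ∼-cong (λ i → snd (r i))
      consequence-sound snd (inj₂ (inj₂ (inj₂ (inj₂ (inj₁ p))))) with _ , k∈ , refl , refl ← find p = ∼-con k∈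
      consequence-sound snd (inj₂ (inj₂ (inj₂ (inj₂ (inj₂ p)))))
        with _ , ρ∈ , q ← find p
        with σ , refl , refl ← Any.satisfied q = ∼-rule ρ∈ σ

      conclusion : ∀ {A e} → Consequence A e → Flat × Flat
      conclusion {e = e} _ = e

      extend-sound : ∀ {A e} (p : Consequence A e) → Sound A → Sound (conclusion p ∷ A)
      extend-sound p snd (here refl) = consequence-sound snd p
      extend-sound p snd (there e∈)  = snd e∈

      conclusion-key : ∀ {A e} (p : Consequence A e) → conclusion p ≡ e
      conclusion-key _ = refl

      open Saturation id Consequence consequence? conclusion conclusion-key Sound extend-sound

      abstract
        saturated : ∃ λ A → Sound A × Saturated (cartesianProduct flats flats) A
        saturated = saturate (cartesianProduct flats flats) λ ()

      module _ {ρ : Const → Const} (fix : FixesKs ρ) (ρ∈L : ∀ c → ρ c ∈ L) where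

        A : List (Flat × Flat)
        A = proj₁ saturated

        rename∈flats : ∀ s → rename ρ s ∈ flats
        rename∈flats s = ∈-flats (rename ρ s) (Over-rename ρ s (over s))
          where
          over : ∀ s → Over ((_∈ L) ∘ ρ) s
          over (elem c)      = ρ∈L c
          over (node f cs) i = ρ∈L (lookup cs i)

        close : ∀ s t → Consequence A (rename ρ s , rename ρ t) → (rename ρ s , rename ρ t) ∈ A
        close s t p with proj₂ (proj₂ saturated) (∈-cartesianProduct⁺ (rename∈flats s) (rename∈flats t))
        ... | inj₁ (_ , e∈ , refl) = e∈
        ... | inj₂ ¬p = contradiction p ¬p

        -- A derivation may pass through constants outside `L`, but its image under `ρ` does not.
        -- Each renamed step is a `Consequence` of the renamed premises, and saturation puts it in
        -- `A`.
        complete : ∀ {s t} → s ∼ t → (rename ρ s , rename ρ t) ∈ A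
        complete {s} {t} ∼-refl          = close s t (inj₁ refl)
        complete {s} {t} (∼-sym p)       = close s t (inj₂ (inj₁ (complete p)))
        complete {s} {t} (∼-trans {t = u} p q) =
          close s t (inj₂ (inj₂ (inj₁ (lose (rename∈flats u) (complete p , complete q)))))
        complete {s} {t} (∼-cong {f} {cs} {ds} p) = close s t (inj₂ (inj₂ (inj₂ (inj₁
          (f , lose (map∈ cs) (lose (map∈ ds) (refl , refl , λ i →
            subst₂ (λ c d → (elem c , elem d) ∈ A) (sym (lookup-map i ρ cs)) (sym (lookup-map i ρ ds)) (complete (p i)))))))))
          where
          map∈ : ∀ {n} (cs : Vec Const n) → map ρ cs ∈ vecs L n
          map∈ cs = ∈-vecs (map ρ cs) λ i → subst (_∈ L) (sym (lookup-map i ρ cs)) (ρ∈L (lookup cs i))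
        complete {s} {t} (∼-con k∈) = close s t (inj₂ (inj₂ (inj₂ (inj₂ (inj₁
          (lose k∈ (cong elem (fix k∈) , rename-unfold ρ fix k∈)))))))
        complete {s} {t} (∼-rule {r} r∈ σ)
          with τ , τ∈ , agree ← ∈-assignments (ρ ∘ σ) (λ x → ρ∈L (σ x)) (ruleVars r) =
          close s t (inj₂ (inj₂ (inj₂ (inj₂ (inj₂ (lose r∈ (lose τ∈
            ( trans (rename-flatten ρ fix σ (proj₁ (sides r∈))) (flatten-agree (lhs r) (agree ∘ ∈-++⁺ˡ))
            , trans (rename-flatten ρ fix σ (proj₂ (sides r∈))) (flatten-agree (rhs r) (agree ∘ ∈-++⁺ʳ (sideVars (lhs r)))))))))))) 

    default : Const
    default = genVar 0

    restrict : List Const → Const → Const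
    restrict L c with c ∈ᶜ? L
    ... | yes _ = c
    ... | no  _ = default

    restrict-∈ : ∀ {L} → default ∈ L → ∀ c → restrict L c ∈ L
    restrict-∈ {L} d∈ c with c ∈ᶜ? L
    ... | yes c∈ = c∈
    ... | no  _  = d∈

    restrict-id : ∀ {L c} → c ∈ L → restrict L c ≡ c
    restrict-id {L} {c} c∈ with c ∈ᶜ? L
    ... | yes _  = refl
    ... | no  c∉ = contradiction c∈ c∉

    infix 4 _∼?_

    -- Renaming all other constants to the default one keeps a derivation valid,
    -- so the finitely many constants of Ks, s and t suffice.
    _∼?_ : ∀ s t → Dec (s ∼ t)
    s ∼? t = map′ (proj₁ (proj₂ saturated))
      (λ p → subst₂ (λ s t → (s , t) ∈ proj₁ saturated) s≡ t≡
        (complete (λ k∈ → restrict-id (there (∈-++⁺ˡ (∈-map⁺ kon k∈)))) (restrict-∈ (here refl)) p))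
      ((s , t) ∈? proj₁ saturated)
      where
      L : List Const
      L = default ∷ kons ++ consts s ++ consts t
      open Finite L
      open DecMembership (≡-dec _≟ᶠ_ _≟ᶠ_) using (_∈?_)
      s≡ : rename (restrict L) s ≡ s
      s≡ = rename-id s (Over-map (λ c∈ → restrict-id (there (∈-++⁺ʳ kons (∈-++⁺ˡ c∈)))) s (Over-consts s))
      t≡ : rename (restrict L) t ≡ t
      t≡ = rename-id t (Over-map (λ c∈ → restrict-id (there (∈-++⁺ʳ kons (∈-++⁺ʳ (consts s) c∈)))) t (Over-consts t))

    -- `restrict L` fixes `s` and moves any witness `c` into `L`, so the infinite search for `c`
    -- reduces to a finite one.
    elementary? : ∀ s → Dec (∃ λ c → s ∼ elem c)
    elementary? s = map′ (λ p → let c , _ , q = find p in c , q)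
      (λ (c , p) → lose (restrict-∈ (here refl) c)
        (subst (_∼ elem (restrict L c)) (rename-id s (Over-map (λ c∈ → restrict-id (there (∈-++⁺ʳ kons c∈))) s (Over-consts s)))
          (rename-∼ (restrict L) (λ k∈ → restrict-id (there (∈-++⁺ˡ (∈-map⁺ kon k∈)))) p)))
      (any? (λ c → s ∼? elem c) L)
      where L = default ∷ kons ++ consts s

    -- Any interpretation θ of flat terms by constants that respects ∼ and fixes
    -- constants is a model of R: it is never constrained by terms of greater depth.
    module Model
      (θ : Flat → Const) (θ-resp : ∀ {s t} → s ∼ t → elem (θ s) ∼ elem (θ t))
      (θ-elem : ∀ c → elem (θ (elem c)) ∼ elem c)
      where

      eval  : Term F → Const
      eval* : ∀ {n} → Vec (Term F) n → Vec Const n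
      eval (var x)    = gen (var x)
      eval (app f ts) = θ (node f (eval* ts))
      eval* []       = []
      eval* (t ∷ ts) = eval t ∷ eval* ts

      lookup-eval* : ∀ {n} (ts : Vec (Term F) n) i → lookup (eval* ts) i ≡ eval (lookup ts i)
      lookup-eval* (t ∷ ts) zero    = refl
      lookup-eval* (t ∷ ts) (suc i) = lookup-eval* ts i

      infix 4 _≐_

      _≐_ : Const → Const → Set
      c ≐ d = elem c ∼ elem d

      θ-node : ∀ {f cs} ts → (∀ i → lookup cs i ≐ eval (lookup ts i)) → θ (node f cs) ≐ eval (app f ts)
      θ-node ts p = θ-resp (∼-cong λ i → ∼-trans (p i) (≡⇒∼ (cong elem (sym (lookup-eval* ts i)))))

      -- By induction the arguments of `k` evaluate to their own constants, so `k` evaluates to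
      -- `θ (unfold k)`; `∼-con` and `θ-elem` identify this with `kon k`.
      θ-unfold : ∀ k → k ∈ Ks → eval k ≐ kon k
      θ-unfold = term-ind _ (λ x x∈ → contradiction (proj₂ (proj₂ (Ks-app x∈))) λ ())
        λ f ts ih k∈ → ∼-trans
          (∼-sym (θ-node ts λ i → ∼-trans (≡⇒∼ (cong elem (lookup-map i kon ts))) (∼-sym (ih i (Ks-closed k∈ i)))))
          (∼-trans (θ-resp (∼-sym (∼-con k∈))) (θ-elem _))

      eval-arg : ∀ σ {t} → Arg t → konArg (eval ∘ σ) t ≐ eval (t ⟨ σ ⟩)
      eval-arg σ var = ∼-refl
      eval-arg σ {k} (con k∈) = ∼-trans (≡⇒∼ (cong elem (konArg-con k∈)))
        (∼-trans (∼-sym (θ-unfold k k∈)) (≡⇒∼ (cong (elem ∘ eval) (sym (Ks-ground k k∈ σ)))))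

      -- Shallowness enters here: the arguments of a side are variables or members of `Ks`, so the
      -- value of an instance depends only on the values given to the variables, as in a flat term.
      eval-side : ∀ σ {t} → Side t → θ (flatten (eval ∘ σ) t) ≐ eval (t ⟨ σ ⟩)
      eval-side σ var = θ-elem _
      eval-side σ (app {f} {ts} args) = θ-node (ts ⟨ σ ⟩*) λ i →
        ∼-trans (≡⇒∼ (cong elem (lookup-map i (konArg (eval ∘ σ)) ts)))
          (∼-trans (eval-arg σ (args i)) (≡⇒∼ (cong (elem ∘ eval) (sym (lookup-⟨⟩* ts σ i)))))

      eval-step : ∀ {t u} → Step R t u → eval t ≐ eval u
      eval-step (root ρ∈ σ) = ∼-trans (∼-sym (eval-side σ (proj₁ (sides ρ∈))))
        (∼-trans (θ-resp (∼-rule ρ∈ (eval ∘ σ))) (eval-side σ (proj₂ (sides ρ∈))))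
      eval-step (arg {f} {ts} {u} i t→u) = θ-node (ts [ i ]≔ u) λ j →
        ∼-trans (≡⇒∼ (cong elem (lookup-eval* ts j))) (eval-update j)
        where
        eval-update : ∀ j → eval (lookup ts j) ≐ eval (lookup (ts [ i ]≔ u) j)
        eval-update j with j Fin.≟ i
        ... | yes refl = ∼-trans (eval-step t→u) (≡⇒∼ (cong (elem ∘ eval) (sym (lookup∘update i ts u))))
        ... | no j≢i   = ≡⇒∼ (cong (elem ∘ eval) (sym (lookup∘update′ j≢i ts u)))

      eval-≈ : ∀ {t u} → t ≈ u → eval t ≐ eval u
      eval-≈ = EqClosure.gfold ∼-isEquivalence (elem ∘ eval) eval-step

    -- Normal forms and matching.

    NF : Term F → Set
    NF = IsNormalForm (Step R)

    Redex : Term F → Set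
    Redex t = Any (λ ρ → ∃ λ σ → lhs ρ ⟨ σ ⟩ ≡ t) R

    step⁻ : ∀ {t u} → Step R t u → Redex t ⊎ ∃ λ f → ∃₂ λ ts i → t ≡ app f ts × ∃ (Step R (lookup ts i))
    step⁻ (root ρ∈ σ)      = inj₁ (lose ρ∈ (σ , refl))
    step⁻ (arg {ts = ts} i t→u) = inj₂ (_ , ts , i , refl , _ , t→u)

    redex⇒step : ∀ {t} → Redex t → ∃ (Step R t)
    redex⇒step r with _ , ρ∈ , σ , refl ← find r = _ , root ρ∈ σ

    step-⟨⟩ : ∀ τ {t u} → Step R t u → Step R (t ⟨ τ ⟩) (u ⟨ τ ⟩)
    step-⟨⟩ τ (root {ρ} ρ∈ σ) =
      subst₂ (Step R) (sym (⟨⟩-∘ σ τ (lhs ρ))) (sym (⟨⟩-∘ σ τ (rhs ρ))) (root ρ∈ _)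
    step-⟨⟩ τ (arg {f} {ts} {u} i t→u) =
      subst (Step R (app f ts ⟨ τ ⟩)) (cong (app f) (update-⟨⟩* ts i))
        (arg i (subst (λ t → Step R t (u ⟨ τ ⟩)) (sym (lookup-⟨⟩* ts τ i)) (step-⟨⟩ τ t→u)))
      where
      update-⟨⟩* : ∀ {n} (ts : Vec (Term F) n) i → (ts ⟨ τ ⟩*) [ i ]≔ (u ⟨ τ ⟩) ≡ (ts [ i ]≔ u) ⟨ τ ⟩*
      update-⟨⟩* (t ∷ ts) zero    = refl
      update-⟨⟩* (t ∷ ts) (suc i) = cong (t ⟨ τ ⟩ ∷_) (update-⟨⟩* ts i)

    -- Steps are stable under substitution. This allows a normal form to be generalised by putting
    -- variables in place of subterms.
    NF-⟨⟩⁻ : ∀ τ {t} → NF (t ⟨ τ ⟩) → NF t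
    NF-⟨⟩⁻ τ nf (u , t→u) = nf (_ , step-⟨⟩ τ t→u)

    NF-lookup : ∀ {f ts} → NF (app f ts) → ∀ i → NF (lookup ts i)
    NF-lookup nf i (u , t→u) = nf (_ , arg i t→u)

    NF-var : ∀ x → NF (var x)
    NF-var x (u , x→u) with step⁻ x→u
    ... | inj₂ (_ , _ , _ , () , _)
    ... | inj₁ r with find r
    ... | ρ , _ , σ , eq with lhs ρ in lhs≡
    ... | var y = lhs-¬var ρ y lhs≡

    -- For an application it suffices to test the single candidate `σ₀`, which reads the value of
    -- each variable off some argument where it occurs. Any matcher agrees with `σ₀` on all
    -- arguments, repeated variables included, and ground arguments are fixed by every substitution.
    match? : ∀ {l} → Side l → ∀ t → Dec (∃ λ σ → l ⟨ σ ⟩ ≡ t)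
    match? var t = yes (const t , refl)
    match? (app args) (var x) = no λ ()
    match? (app {f} {ls} args) (app g ts) with f Fin.≟ g
    ... | no f≢g   = no λ { (σ , refl) → f≢g refl }
    ... | yes refl = map′ (σ₀ ,_) (λ (σ , eq) → cong (app f) (vec-ext λ i → agree σ (app⁻ eq) i))
                          (app f ls ⟨ σ₀ ⟩ ≟ₜ app f ts)
      where
      σ₀ : Substitution
      σ₀ x with Fin.any? (λ i → lookup ls i ≟ₜ var x)
      ... | yes (i , _) = lookup ts i
      ... | no  _       = var x

      app⁻ : ∀ {us vs} → app f us ≡ app f vs → us ≡ vs
      app⁻ refl = refl

      agree-arg : ∀ σ → ls ⟨ σ ⟩* ≡ ts → ∀ i {l} → lookup ls i ≡ l → Arg l → l ⟨ σ₀ ⟩ ≡ lookup ts i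
      agree-arg σ eq i l≡ (con k∈) = trans (trans (Ks-ground _ k∈ σ₀) (sym (trans (cong (_⟨ σ ⟩) l≡) (Ks-ground _ k∈ σ))))
        (trans (sym (lookup-⟨⟩* ls σ i)) (cong (λ us → lookup us i) eq))
      agree-arg σ eq i l≡ (var {x}) with Fin.any? (λ i → lookup ls i ≟ₜ var x)
      ... | no ¬p = contradiction (i , l≡) ¬p
      ... | yes (j , lⱼ≡) = trans (value j lⱼ≡) (sym (value i l≡))
        where
        value : ∀ j → lookup ls j ≡ var x → lookup ts j ≡ σ x
        value j lⱼ≡ = trans (cong (λ us → lookup us j) (sym eq)) (trans (lookup-⟨⟩* ls σ j) (cong (_⟨ σ ⟩) lⱼ≡))

      agree : ∀ σ → ls ⟨ σ ⟩* ≡ ts → ∀ i → lookup (ls ⟨ σ₀ ⟩*) i ≡ lookup ts i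
      agree σ eq i = trans (lookup-⟨⟩* ls σ₀ i) (agree-arg σ eq i refl (args i))

    step? : ∀ t → Dec (∃ (Step R t))
    step? = term-ind _ (λ x → no (NF-var x)) λ f ts ih → map′
      [ redex⇒step , (λ (i , u , t→u) → _ , arg i t→u) ]′
      (λ (u , t→u) → split (step⁻ t→u))
      (any∈? R (λ ρ∈ → match? (proj₁ (sides ρ∈)) (app f ts)) ⊎-dec Fin.any? ih)
      where
      split : ∀ {f ts} → Redex (app f ts) ⊎ (∃ λ g → ∃₂ λ us i → app f ts ≡ app g us × ∃ (Step R (lookup us i))) →
              Redex (app f ts) ⊎ ∃ λ i → ∃ (Step R (lookup ts i))
      split (inj₁ r)                      = inj₁ r
      split (inj₂ (_ , _ , i , refl , p)) = inj₂ (i , p)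

    NF? : ∀ t → Dec (NF t)
    NF? t = ¬? (step? t)

    -- Tables of ground normal forms and the values they induce.

    Table : Set
    Table = List (Term F × Term F)

    find-entry : Table → Term F → Maybe (Term F)
    find-entry []            k = nothing
    find-entry ((l , u) ∷ S) k with l ≟ₜ k
    ... | yes _ = just u
    ... | no  _ = find-entry S k

    find-entry⇒∈ : ∀ S {k u} → find-entry S k ≡ just u → (k , u) ∈ S
    find-entry⇒∈ ((l , u) ∷ S) {k} eq with l ≟ₜ k
    find-entry⇒∈ ((l , u) ∷ S) refl | yes refl = here refl
    ... | no _ = there (find-entry⇒∈ S eq)

    -- An earlier entry may shadow this one, so `v` can differ from `u`.
    ∈⇒find-entry : ∀ S {k u} → (k , u) ∈ S → ∃ λ v → find-entry S k ≡ just v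
    ∈⇒find-entry ((l , v) ∷ S) {k} k∈ with l ≟ₜ k
    ∈⇒find-entry ((l , v) ∷ S) k∈          | yes _  = v , refl
    ∈⇒find-entry ((l , v) ∷ S) (here refl) | no l≢k = contradiction refl l≢k
    ∈⇒find-entry ((l , v) ∷ S) (there k∈)  | no _   = ∈⇒find-entry S k∈

    data ConstValue (S : Table) : Const → Term F → Set where
      kon : ∀ {k u} → find-entry S k ≡ just u → ConstValue S (kon k) u
      gen : ∀ {t} → NF t → ConstValue S (gen t) t

    -- Partial, so that over a correct table all values are normal forms; two distinct values of
    -- equivalent flat terms then refute `UN⁼`.
    data Value (S : Table) : Flat → Term F → Set where
      elem : ∀ {c u} → ConstValue S c u → Value S (elem c) u
      node : ∀ {f cs us} → (∀ i → ConstValue S (lookup cs i) (lookup us i)) → NF (app f us) →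
             Value S (node f cs) (app f us)

    constValue-unique : ∀ {S c u v} → ConstValue S c u → ConstValue S c v → u ≡ v
    constValue-unique (kon p) (kon q) = just-injective (trans (sym p) q)
    constValue-unique (gen _) (gen _) = refl

    value-unique : ∀ {S s u v} → Value S s u → Value S s v → u ≡ v
    value-unique (elem p)           (elem q)   = constValue-unique p q
    value-unique (node {f = f} p _) (node q _) = cong (app f) (vec-ext λ i → constValue-unique (p i) (q i))

    constValue? : ∀ S c → Dec (∃ (ConstValue S c))
    constValue? S (gen t) = map′ (λ nf → t , gen nf) (λ { (_ , gen nf) → nf }) (NF? t)
    constValue? S (kon k) with find-entry S k in eq
    ... | just u  = yes (u , kon eq)
    ... | nothing = no λ { (u , kon p) → contradiction (trans (sym p) eq) λ () }

    value? : ∀ S s → Dec (∃ (Value S s))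
    value? S (elem c) = map′ (λ (u , p) → u , elem p) (λ { (u , elem p) → u , p }) (constValue? S c)
    value? S (node f cs) with Fin.all? (λ i → constValue? S (lookup cs i))
    ... | no ¬p = no λ { (_ , node p _) → ¬p λ i → _ , p i }
    ... | yes p = map′
      (λ nf → _ , node (λ i → subst (ConstValue S (lookup cs i)) (sym (lookup∘tabulate (proj₁ ∘ p) i)) (proj₂ (p i))) nf)
      (λ { (_ , node q nf) → subst (NF ∘ app f)
        (vec-ext λ i → trans (constValue-unique (q i) (proj₂ (p i))) (sym (lookup∘tabulate (proj₁ ∘ p) i))) nf })
      (NF? (app f (tabulate (proj₁ ∘ p))))

    -- A table assigns normal forms to constants of Ks in their ≈-class.
    record Entry (k u : Term F) : Set where
      field
        key∈Ks     : k ∈ Ks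
        normal     : NF u
        ground     : ∀ σ → u ⟨ σ ⟩ ≡ u
        equivalent : u ≈ k
    open Entry

    Correct : Table → Set
    Correct S = ∀ {k u} → (k , u) ∈ S → Entry k u

    module _ {S : Table} (correct : Correct S) where

      entry : ∀ {k u} → find-entry S k ≡ just u → Entry k u
      entry = correct ∘ find-entry⇒∈ S

      constValue-NF : ∀ {c u} → ConstValue S c u → NF u
      constValue-NF (kon p)  = normal (entry p)
      constValue-NF (gen nf) = nf

      value-NF : ∀ {s u} → Value S s u → NF u
      value-NF (elem p)    = constValue-NF p
      value-NF (node _ nf) = nf

      constValue-≈ : ∀ {c u} → ConstValue S c u → u ≈ ⌊ c ⌋ᶜ
      constValue-≈ (kon p) = equivalent (entry p)
      constValue-≈ (gen _) = ≈-refl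

      value-≈ : ∀ {s u} → Value S s u → u ≈ ⌊ s ⌋
      value-≈ (elem p) = constValue-≈ p
      value-≈ (node {cs = cs} {us} p _) = ≈-cong us (map ⌊_⌋ᶜ cs) λ i →
        subst (lookup us i ≈_) (sym (lookup-map i ⌊_⌋ᶜ cs)) (constValue-≈ (p i))

      kon-ground : ∀ {c u} → c ∈ kons → ConstValue S c u → ∀ σ → u ⟨ σ ⟩ ≡ u
      kon-ground c∈ p σ with _ , _ , refl ← ∈-map⁻ kon c∈ with kon q ← p = ground (entry q) σ

    -- Restricting `cs` to `kons` keeps the search finite and the new entry ground. By
    -- `find-entry-∼` nothing is lost if the saturated table has no conflict.
    Derivable : Table → Term F → ∀ f → Vec Const (arity f) → Set
    Derivable S k f cs = (∀ i → lookup cs i ∈ kons) × node f cs ∼ elem (kon k) × ∃ (Value S (node f cs))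

    Assignable : Table → Term F → Set
    Assignable S k = k ∈ Ks × ∃ λ f → Any (Derivable S k f) (vecs kons (arity f))

    assignable? : ∀ S k → Dec (Assignable S k)
    assignable? S k = k ∈? Ks ×-dec Fin.any? λ f → any? (λ cs →
      Fin.all? (λ i → lookup cs i ∈ᶜ? kons) ×-dec (node f cs ∼? elem (kon k)) ×-dec value? S (node f cs))
      (vecs kons (arity f))
      where open DecMembership _≟ₜ_ using (_∈?_)

    assign : ∀ {S k} → Assignable S k → Term F × Term F
    assign {k = k} (_ , _ , p) = k , proj₁ (proj₂ (proj₂ (proj₂ (Any.satisfied p))))

    derivable-entry : ∀ {S} → Correct S → ∀ {k f cs} → k ∈ Ks →
                      (p : Derivable S k f cs) → Entry k (proj₁ (proj₂ (proj₂ p)))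
    derivable-entry correct {f = f} k∈ (cs∈ , s∼k , u , v@(node {us = us} p nf)) = record
      { key∈Ks     = k∈
      ; normal     = nf
      ; ground     = λ σ → cong (app f) (⟨⟩*-intro us λ i → kon-ground correct (cs∈ i) (p i) σ)
      ; equivalent = ≈-trans (value-≈ correct v) (sound s∼k)
      }

    assign-correct : ∀ {S k} (p : Assignable S k) → Correct S → Correct (assign p ∷ S)
    assign-correct (k∈ , _ , p) correct (here refl) = derivable-entry correct k∈ (proj₂ (Any.satisfied p))
    assign-correct p            correct (there e∈)  = correct e∈

    assign-key : ∀ {S k} (p : Assignable S k) → proj₁ (assign p) ≡ k
    assign-key _ = refl

    open Saturation proj₁ Assignable assignable? assign assign-key Correct assign-correct

    -- The finite conflict test.

    Conflict : Table → Flat → Flat → Set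
    Conflict S s t = s ∼ t × ∃₂ λ u v → Value S s u × Value S t v × u ≢ v

    conflict? : ∀ S s t → Dec (Conflict S s t)
    conflict? S s t with s ∼? t | value? S s | value? S t
    ... | no s≁t  | _           | _           = no λ (s∼t , _) → s≁t s∼t
    ... | yes _   | no ¬p       | _           = no λ (_ , _ , _ , p , _) → ¬p (_ , p)
    ... | yes _   | yes _       | no ¬q       = no λ (_ , _ , _ , _ , q , _) → ¬q (_ , q)
    ... | yes s∼t | yes (u , p) | yes (v , q) = map′ (λ u≢v → s∼t , u , v , p , q , u≢v)
      (λ (_ , _ , _ , p′ , q′ , u≢v) u≡v → u≢v (trans (value-unique p′ p) (trans u≡v (value-unique q q′))))
      (¬? (u ≟ₜ v))

    conflict⇒¬UN⁼ : ∀ {S s t} → Correct S → Conflict S s t → ¬ UN⁼ R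
    conflict⇒¬UN⁼ correct (s∼t , u , v , p , q , u≢v) un =
      un (u , v , value-NF correct p , value-NF correct q , u≢v ,
          ≈-trans (value-≈ correct p) (≈-trans (sound s∼t) (≈-sym (value-≈ correct q))))

    -- Bounds the number of constants in a flat term: the sum covers every arity, and the extra 1
    -- covers `elem` when all arities are 0.
    width : ℕ
    width = suc (sum (List.map arity (allFin size)))

    length-consts : ∀ s → length (consts s) ≤ width
    length-consts (elem c)    = s≤s z≤n
    length-consts (node f cs) = subst (_≤ width) (sym (length-toList cs)) (ℕ.m≤n⇒m≤1+n (∈-sum arity (∈-allFin f)))

    -- A conflict involves two flat terms, hence twice `width` variables are provided.
    testConsts : List Const
    testConsts = kons ++ List.map genVar (upTo (width + width))

    open Finite testConsts using (flats; ∈-flats)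

    -- Values of flat terms with arbitrary constants are compared by renaming
    -- the constants outside Ks to variables, numbered by their position in ys.
    position : List Const → Const → ℕ
    position []       c = 0
    position (y ∷ ys) c with y ≟ᶜ c
    ... | yes _ = 0
    ... | no  _ = suc (position ys c)

    nth : List Const → ℕ → Const
    nth []       n       = default
    nth (y ∷ ys) zero    = y
    nth (y ∷ ys) (suc n) = nth ys n

    position-< : ∀ {ys c} → c ∈ ys → position ys c < length ys
    position-< {y ∷ ys} {c} c∈ with y ≟ᶜ c
    position-< c∈          | yes _  = z<s
    position-< (here refl) | no y≢c = contradiction refl y≢c
    position-< (there c∈)  | no _   = s<s (position-< c∈)

    nth-position : ∀ {ys c} → c ∈ ys → nth ys (position ys c) ≡ c
    nth-position {y ∷ ys} {c} c∈ with y ≟ᶜ c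
    nth-position c∈          | yes y≡c = y≡c
    nth-position (here refl) | no y≢c  = contradiction refl y≢c
    nth-position (there c∈)  | no _    = nth-position c∈

    -- The offset `d` yields numberings that disagree on every constant outside `kons`;
    -- `find-entry-∼` plays `d = 0` against `d = 1`.
    number : ℕ → List Const → Const → Const
    number d ys c with c ∈ᶜ? kons
    ... | yes _ = c
    ... | no  _ = gen (var (d + position ys c))

    number-kon : ∀ d ys {c} → c ∈ kons → number d ys c ≡ c
    number-kon d ys {c} c∈ with c ∈ᶜ? kons
    ... | yes _  = refl
    ... | no  c∉ = contradiction c∈ c∉

    number-gen : ∀ d ys {c} → ¬ c ∈ kons → number d ys c ≡ gen (var (d + position ys c))
    number-gen d ys {c} c∉ with c ∈ᶜ? kons
    ... | yes c∈ = contradiction c∈ c∉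
    ... | no  _  = refl

    number-fixes : ∀ d ys → FixesKs (number d ys)
    number-fixes d ys k∈ = number-kon d ys (∈-map⁺ kon k∈)

    number-test : ∀ {ys c} → length ys ≤ width + width → c ∈ ys → number 0 ys c ∈ testConsts
    number-test {ys} {c} bound c∈ with c ∈ᶜ? kons
    ... | yes c∈K = ∈-++⁺ˡ c∈K
    ... | no  _   = ∈-++⁺ʳ kons (∈-map⁺ genVar (∈-upTo⁺ (ℕ.<-≤-trans (position-< c∈) bound)))

    denumber : ℕ → List Const → Substitution
    denumber d ys n = ⌊ nth ys (n ∸ d) ⌋ᶜ

    -- Consequences of a passed conflict test.

    module Tested {S : Table} (correct : Correct S) (¬conflict : ¬ Any (λ s → Any (Conflict S s) flats) flats)
      (complete : Saturated Ks S) where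

      constValue-number : ∀ d {ys c u} → c ∈ ys → ConstValue S c u →
                          ∃ λ v → ConstValue S (number d ys c) v × v ⟨ denumber d ys ⟩ ≡ u
      constValue-number d {ys} {c} {u} c∈ p with c ∈ᶜ? kons
      ... | yes c∈K = u , p , kon-ground correct c∈K p _
      ... | no  c∉K = var (d + position ys c) , gen (NF-var _) ,
          trans (cong (λ n → ⌊ nth ys n ⌋ᶜ) (ℕ.m+n∸m≡n d (position ys c)))
                (trans (cong ⌊_⌋ᶜ (nth-position c∈)) (sym (value≡ p c∉K)))
        where
        value≡ : ∀ {c u} → ConstValue S c u → ¬ c ∈ kons → u ≡ ⌊ c ⌋ᶜ
        value≡ (kon q) c∉ = contradiction (∈-map⁺ kon (key∈Ks (entry correct q))) c∉
        value≡ (gen _) c∉ = refl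

      -- `v` arises from `u` by putting variables for the values of the constants outside `kons`. It
      -- is normal because its instance `u` is, and the values of constants in `kons` are ground,
      -- hence untouched by `denumber`.
      value-number : ∀ d {ys} s {u} → Over (_∈ ys) s → Value S s u →
                     ∃ λ v → Value S (rename (number d ys) s) v × v ⟨ denumber d ys ⟩ ≡ u
      value-number d (elem c) c∈ (elem p) with v , q , eq ← constValue-number d c∈ p = v , elem q , eq
      value-number d {ys} (node f cs) cs∈ (node {us = us} p nf) = app f vs , node q nf′ , v≡
        where
        numbered : ∀ i → ∃ λ v → ConstValue S (number d ys (lookup cs i)) v × v ⟨ denumber d ys ⟩ ≡ lookup us i
        numbered i = constValue-number d (cs∈ i) (p i)
        vs : Vec (Term F) (arity f)
        vs = tabulate (proj₁ ∘ numbered)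
        lookup-vs : ∀ i → lookup vs i ≡ proj₁ (numbered i)
        lookup-vs = lookup∘tabulate (proj₁ ∘ numbered)
        v≡ : app f vs ⟨ denumber d ys ⟩ ≡ app f us
        v≡ = cong (app f) (⟨⟩*-intro vs λ i →
          trans (cong (_⟨ denumber d ys ⟩) (lookup-vs i)) (proj₂ (proj₂ (numbered i))))
        nf′ : NF (app f vs)
        nf′ = NF-⟨⟩⁻ (denumber d ys) (subst NF (sym v≡) nf)
        q : ∀ i → ConstValue S (lookup (map (number d ys) cs) i) (lookup vs i)
        q i = subst₂ (ConstValue S) (sym (lookup-map i (number d ys) cs)) (sym (lookup-vs i)) (proj₁ (proj₂ (numbered i)))

      -- Extends the finite test to all flat terms. Numbering the constants of `s` and `t` jointly
      -- gives a tested pair whose values must coincide, and one substitution carries both values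
      -- back to `u` and `v`.
      value-resp : ∀ {s t u v} → s ∼ t → Value S s u → Value S t v → u ≡ v
      value-resp {s} {t} s∼t p q
        with u′ , p′ , refl ← value-number 0 {consts s ++ consts t} s (Over-map ∈-++⁺ˡ s (Over-consts s)) p
        with v′ , q′ , refl ← value-number 0 {consts s ++ consts t} t (Over-map (∈-++⁺ʳ (consts s)) t (Over-consts t)) q
        with u′ ≟ₜ v′
      ... | yes u′≡v′ = cong (_⟨ denumber 0 (consts s ++ consts t) ⟩) u′≡v′
      ... | no  u′≢v′ = contradiction
          (lose (test∈ s (Over-map ∈-++⁺ˡ s (Over-consts s)))
            (lose (test∈ t (Over-map (∈-++⁺ʳ (consts s)) t (Over-consts t)))
              (rename-∼ (number 0 ys) (number-fixes 0 ys) s∼t , u′ , v′ , p′ , q′ , u′≢v′))) ¬conflict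
        where
        ys : List Const
        ys = consts s ++ consts t
        test∈ : ∀ r → Over (_∈ ys) r → rename (number 0 ys) r ∈ flats
        test∈ r over = ∈-flats _ (Over-rename (number 0 ys) r (Over-map (number-test
          (subst (_≤ width + width) (sym (length-++ (consts s)))
            (ℕ.+-mono-≤ (length-consts s) (length-consts t)))) r over))

      -- If `c` is among `cs`, then `value-resp` makes the value of the node equal to one of its own
      -- arguments. Otherwise `c` can be renamed to two different variables while the node stays
      -- fixed, which makes these variables equivalent.
      node-≁-gen : ∀ {f cs u c} → Value S (node f cs) u → ¬ c ∈ kons → ¬ node f cs ∼ elem c
      node-≁-gen {f} {cs} {c = c} (node {us = us} p nf) c∉ s∼c with c ∈ᶜ? toList cs
      ... | yes c∈ with i , refl ← ∈toList⇒lookup cs c∈ =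
        app≢lookup f us i (value-resp s∼c (node p nf) (elem (p i)))
      ... | no c∉cs = contradiction
          (value-resp (∼-trans (∼-sym (move 0)) (move 1)) (elem (gen (NF-var 0))) (elem (gen (NF-var 1)))) λ ()
        where
        to : ℕ → Const → Const
        to n d with d ≟ᶜ c
        ... | yes _ = gen (var n)
        ... | no  _ = d
        to-≢ : ∀ n {d} → d ≢ c → to n d ≡ d
        to-≢ n {d} d≢c with d ≟ᶜ c
        ... | yes d≡c = contradiction d≡c d≢c
        ... | no  _   = refl
        to-≡ : ∀ n → to n c ≡ gen (var n)
        to-≡ n with c ≟ᶜ c
        ... | yes _  = refl
        ... | no c≢c = contradiction refl c≢c
        move : ∀ n → node f cs ∼ elem (gen (var n))
        move n = subst₂ _∼_
          (rename-id (node f cs) λ i → to-≢ n λ eq → c∉cs (subst (_∈ toList cs) eq (lookup∈toList cs i)))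
          (cong elem (to-≡ n))
          (rename-∼ (to n) (λ k∈ → to-≢ n λ eq → c∉ (subst (_∈ kons) eq (∈-map⁺ kon k∈))) s∼c)

      -- Completeness of the table: an existing entry for `k` equals `u` by `value-resp`, and a
      -- missing one contradicts saturation once all of `cs` is known to lie in `kons`.
      find-entry-∼ : ∀ {f cs u k} → k ∈ Ks → node f cs ∼ elem (kon k) → Value S (node f cs) u →
                     find-entry S k ≡ just u
      find-entry-∼ {f} {cs} {u} {k} k∈ s∼k p with complete k∈
      ... | inj₁ (_ , k∈S , refl) with v , eq ← ∈⇒find-entry S k∈S =
        trans eq (cong just (value-resp (∼-sym s∼k) (elem (kon eq)) p))
      -- A constant outside Ks among cs would get two different names under the
      -- two numberings, and hence a class with two different values.
      ... | inj₂ ¬assignable = contradiction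
          (k∈ , f , lose (∈-vecs cs cs∈) (cs∈ , s∼k , u , p)) ¬assignable
        where
        ys : List Const
        ys = toList cs
        renumbered : ∀ d → rename (number d ys) (node f cs) ∼ elem (kon k)
        renumbered d = subst (λ c → rename (number d ys) (node f cs) ∼ elem c) (number-fixes d ys k∈)
          (rename-∼ (number d ys) (number-fixes d ys) s∼k)
        gen-value : ∀ {t u} → ConstValue S (gen t) u → u ≡ t
        gen-value (gen _) = refl
        var-value : ∀ {i v} d → ¬ lookup cs i ∈ kons → ConstValue S (lookup (map (number d ys) cs) i) v →
                    v ≡ var (d + position ys (lookup cs i))
        var-value {i} {v} d c∉ q = gen-value
          (subst (λ c → ConstValue S c v) (trans (lookup-map i (number d ys) cs) (number-gen d ys c∉)) q)
        suc≢ : ∀ {n} → var {F} n ≢ var (suc n)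
        suc≢ ()
        cs∈ : ∀ i → lookup cs i ∈ kons
        cs∈ i with lookup cs i ∈ᶜ? kons
        ... | yes c∈ = c∈
        ... | no  c∉
          with _ , v₀@(node q₀ _) , _ ← value-number 0 (node f cs) (lookup∈toList cs) p
          with _ , v₁@(node q₁ _) , _ ← value-number 1 (node f cs) (lookup∈toList cs) p
          with refl ← value-resp (∼-trans (renumbered 0) (∼-sym (renumbered 1))) v₀ v₁ =
          contradiction (trans (sym (var-value 0 c∉ (q₀ i))) (var-value 1 c∉ (q₁ i))) suc≢

      -- Canonical constants and separation of normal forms.

      name  : Flat → Term F → Const
      name s t with any? (λ k → s ∼? elem (kon k)) Ks
      ... | yes p = kon (proj₁ (find p))
      ... | no  _ = gen t

      canon  : Term F → Const
      canon* : ∀ {n} → Vec (Term F) n → Vec Const n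
      canon (var x)    = genVar x
      canon (app f ts) = name (node f (canon* ts)) (app f ts)
      canon* []       = []
      canon* (t ∷ ts) = canon t ∷ canon* ts

      lookup-canon* : ∀ {n} (ts : Vec (Term F) n) i → lookup (canon* ts) i ≡ canon (lookup ts i)
      lookup-canon* (t ∷ ts) zero    = refl
      lookup-canon* (t ∷ ts) (suc i) = lookup-canon* ts i

      canonFlat : Term F → Flat
      canonFlat (var x)    = elem (genVar x)
      canonFlat (app f ts) = node f (canon* ts)

      -- When `name` picks some `k` of `Ks`, `find-entry-∼` shows that the table entry of `k` is the
      -- term itself. Hence a normal form can be recovered from its canonical constant.
      canon-value : ∀ t → NF t → ConstValue S (canon t) t
      node-value  : ∀ {f} ts → NF (app f ts) → (∀ i → ConstValue S (canon (lookup ts i)) (lookup ts i)) →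
                    Value S (node f (canon* ts)) (app f ts)
      node-value ts nf p = node (λ i → subst (λ c → ConstValue S c (lookup ts i)) (sym (lookup-canon* ts i)) (p i)) nf

      canon-value = term-ind _ (λ x → gen) λ f ts ih nf →
        name-value nf (node-value ts nf λ i → ih i (NF-lookup nf i))
        where
        name-value : ∀ {f cs t} → NF t → Value S (node f cs) t → ConstValue S (name (node f cs) t) t
        name-value {f} {cs} nf p with any? (λ k → node f cs ∼? elem (kon k)) Ks
        ... | no _ = gen nf
        ... | yes q with k , k∈ , s∼k ← find q = kon (find-entry-∼ k∈ s∼k p)

      canonFlat-value : ∀ t → NF t → Value S (canonFlat t) t
      canonFlat-value (var x)    nf = elem (gen nf)
      canonFlat-value (app f ts) nf = node-value ts nf λ i → canon-value (lookup ts i) (NF-lookup nf i)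

      canon-injective : ∀ {t u} → NF t → NF u → elem (canon t) ∼ elem (canon u) → t ≡ u
      canon-injective nf nf′ p = value-resp p (elem (canon-value _ nf)) (elem (canon-value _ nf′))

      gen-cong : ∀ {t u} → t ≡ u → elem (gen t) ∼ elem (gen u)
      gen-cong refl = ∼-refl

      -- The normal forms in P evaluate to their canonical constants, on which
      -- canon is injective; other flat terms may be interpreted at will.
      module Interpretation (P : List (Term F)) (normalP : ∀ {t} → t ∈ P → NF t)
        (closedP : ∀ {f ts} → app f ts ∈ P → ∀ i → lookup ts i ∈ P) where

        -- `θ-elem` forces a class containing constants to be sent to one of them, up to `∼`. The
        -- class of `canonFlat t` goes to the free constant named `t`, and all remaining classes
        -- share `default`. The decisions are arguments so that proofs can split on them.
        θ′ : ∀ {s} → Dec (∃ λ c → s ∼ elem c) → Dec (Any (λ t → s ∼ canonFlat t) P) → Const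
        θ′ (yes (c , _)) _       = c
        θ′ (no _)        (yes p) = gen (proj₁ (find p))
        θ′ (no _)        (no _)  = default

        θ : Flat → Const
        θ s = θ′ (elementary? s) (any? (λ t → s ∼? canonFlat t) P)

        θ′-resp : ∀ {s t} a b a′ b′ → s ∼ t → elem (θ′ {s} a b) ∼ elem (θ′ {t} a′ b′)
        θ′-resp (yes (c , p)) _ (yes (d , q)) _ s∼t = ∼-trans (∼-sym p) (∼-trans s∼t q)
        θ′-resp (yes (c , p)) _ (no ¬q)       _ s∼t = contradiction (c , ∼-trans (∼-sym s∼t) p) ¬q
        θ′-resp (no ¬p)       _ (yes (d , q)) _ s∼t = contradiction (d , ∼-trans s∼t q) ¬p
        θ′-resp (no _) (no ¬p) (no _) (yes q) s∼t = contradiction (Any.map (∼-trans s∼t) q) ¬p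
        θ′-resp (no _) (yes p) (no _) (no ¬q) s∼t = contradiction (Any.map (∼-trans (∼-sym s∼t)) p) ¬q
        θ′-resp (no _) (no _)  (no _) (no _)  s∼t = ∼-refl
        -- The searches for `s` and `t` may stop at different places in `P`, but the normal forms
        -- found are values of equivalent flat terms and so are equal.
        θ′-resp (no _) (yes p) (no _) (yes q) s∼t = gen-cong (value-resp
          (∼-trans (∼-sym (proj₂ (proj₂ (find p)))) (∼-trans s∼t (proj₂ (proj₂ (find q)))))
          (canonFlat-value _ (normalP (proj₁ (proj₂ (find p)))))
          (canonFlat-value _ (normalP (proj₁ (proj₂ (find q))))))

        θ-resp : ∀ {s t} → s ∼ t → elem (θ s) ∼ elem (θ t)
        θ-resp {s} {t} = θ′-resp (elementary? s) (any? (λ u → s ∼? canonFlat u) P)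
                                 (elementary? t) (any? (λ u → t ∼? canonFlat u) P)

        θ-elem : ∀ c → elem (θ (elem c)) ∼ elem c
        θ-elem c with elementary? (elem c)
        ... | yes (d , p) = ∼-sym p
        ... | no ¬p       = contradiction (c , ∼-refl) ¬p

        -- `θ` asks for any constant in the class, `name` for one of `Ks`; by `node-≁-gen` the
        -- answers agree on a node with a value. If there is none, `value-resp` identifies the
        -- member of `P` found by `θ` with `app f ts`.
        θ-canon : ∀ f ts → app f ts ∈ P → elem (θ (node f (canon* ts))) ∼ elem (canon (app f ts))
        θ-canon f ts t∈ = cases (elementary? s) (any? (λ t → s ∼? canonFlat t) P)
          where
          s : Flat
          s = node f (canon* ts)
          p : Value S s (app f ts)
          p = canonFlat-value (app f ts) (normalP t∈)
          cases : ∀ a b → elem (θ′ {s} a b) ∼ elem (canon (app f ts))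
          cases a b with any? (λ k → s ∼? elem (kon k)) Ks
          cases (yes (c , q)) _       | yes r = ∼-trans (∼-sym q) (proj₂ (proj₂ (find r)))
          cases (no ¬q)       _       | yes r = contradiction (_ , proj₂ (Any.satisfied r)) ¬q
          cases (no _)        (yes q) | no _  = gen-cong (sym (value-resp
            (proj₂ (proj₂ (find q))) p (canonFlat-value _ (normalP (proj₁ (proj₂ (find q)))))))
          cases (no _)        (no ¬q) | no _  = contradiction (lose t∈ ∼-refl) ¬q
          cases (yes (c , q)) _       | no ¬r with c ∈ᶜ? kons
          ... | no  c∉ = contradiction q (node-≁-gen p c∉)
          ... | yes c∈ with k , k∈ , refl ← ∈-map⁻ kon c∈ = contradiction (lose k∈ q) ¬r

        open Model θ θ-resp θ-elem

        eval-canon : ∀ t → t ∈ P → elem (eval t) ∼ elem (canon t)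
        eval-canon = term-ind _ (λ x _ → ∼-refl) λ f ts ih t∈ → ∼-trans
          (∼-sym (θ-node ts λ i → ∼-trans (≡⇒∼ (cong elem (lookup-canon* ts i))) (∼-sym (ih i (closedP t∈ i)))))
          (θ-canon f ts t∈)

        ≈⇒≡ : ∀ {t u} → t ∈ P → u ∈ P → t ≈ u → t ≡ u
        ≈⇒≡ t∈ u∈ t≈u = canon-injective (normalP t∈) (normalP u∈)
          (∼-trans (∼-sym (eval-canon _ t∈)) (∼-trans (eval-≈ t≈u) (eval-canon _ u∈)))

      -- A model is built for each pair of normal forms separately: with `P` the list of their
      -- subterms, the search inside `θ` is finite.
      unique : UN⁼ R
      unique (t , u , nft , nfu , t≢u , t≈u) =
        t≢u (≈⇒≡ (∈-++⁺ˡ (∈-subterms t)) (∈-++⁺ʳ (subterms t) (∈-subterms u)) t≈u)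
        where
        normal-subterms : ∀ {v} → v ∈ subterms t ++ subterms u → NF v
        normal-subterms v∈ with ∈-++⁻ (subterms t) v∈
        ... | inj₁ v∈t = subterms-ind NF NF-lookup t nft v∈t
        ... | inj₂ v∈u = subterms-ind NF NF-lookup u nfu v∈u
        closed-subterms : ∀ {f ts} → app f ts ∈ subterms t ++ subterms u → ∀ i → lookup ts i ∈ subterms t ++ subterms u
        closed-subterms v∈ i with ∈-++⁻ (subterms t) v∈
        ... | inj₁ v∈t = ∈-++⁺ˡ (subterms-closed t v∈t i)
        ... | inj₂ v∈u = ∈-++⁺ʳ (subterms t) (subterms-closed u v∈u i)
        open Interpretation (subterms t ++ subterms u) normal-subterms closed-subterms

    UN⁼? : Dec (UN⁼ R)
    UN⁼? with S , correct , complete ← saturate Ks (λ ())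
      with any? (λ s → any? (conflict? S s) flats) flats
    ... | no ¬p = yes (Tested.unique correct ¬p complete)
    ... | yes p = no (conflict⇒¬UN⁼ correct (proj₂ (Any.satisfied (proj₂ (Any.satisfied p)))))

-- Shallow rules have flat sides.

module _ {F : Signature} where
  open Signature F

  Ground : Term F → Set
  Ground t = ∀ x d → ¬ OccursAt x d t

  Ground-lookup : ∀ {f ts} → Ground (app f ts) → ∀ i → Ground (lookup ts i)
  Ground-lookup g i x d x∈ = g x (suc d) (there i x∈)

  ground? : ∀ t → Dec (Ground t)
  ground? = term-ind _ (λ x → no λ g → g x 0 here) λ f ts ih → map′
    (λ { g x (suc d) (there i x∈) → g i x d x∈ }) Ground-lookup (Fin.all? ih)

  module _ (R : TRS F) (shallow : Shallow R) where

    ruleSubterms : Rule F → List (Term F)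
    ruleSubterms ρ = subterms (lhs ρ) ++ subterms (rhs ρ)

    -- Ground subterms of every depth are collected, whole sides included, so that the list is
    -- closed under taking arguments.
    groundSubterms : List (Term F)
    groundSubterms = List.filter ground? (concatMap ruleSubterms R)

    groundSubterms⁺ : ∀ {ρ k} → ρ ∈ R → k ∈ ruleSubterms ρ → Ground k → k ∈ groundSubterms
    groundSubterms⁺ ρ∈ k∈ = ∈-filter⁺ ground? (∈-concatMap⁺ ruleSubterms (lose ρ∈ k∈))

    groundSubterms⁻ : ∀ {k} → k ∈ groundSubterms → Ground k × ∃ λ ρ → ρ ∈ R × k ∈ ruleSubterms ρ
    groundSubterms⁻ k∈ with k∈R , g ← ∈-filter⁻ ground? {xs = concatMap ruleSubterms R} k∈ =
      g , find (∈-concatMap⁻ ruleSubterms k∈R)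

    groundSubterms-app : ∀ {k} → k ∈ groundSubterms → ∃₂ λ f ts → k ≡ app f ts
    groundSubterms-app {var x}    k∈ = contradiction here (proj₁ (groundSubterms⁻ k∈) x 0)
    groundSubterms-app {app f ts} k∈ = f , ts , refl

    groundSubterms-closed : ∀ {f ts} → app f ts ∈ groundSubterms → ∀ i → lookup ts i ∈ groundSubterms
    groundSubterms-closed k∈ i with g , ρ , ρ∈ , k∈ρ ← groundSubterms⁻ k∈
      with ∈-++⁻ (subterms (lhs ρ)) k∈ρ
    ... | inj₁ k∈l = groundSubterms⁺ ρ∈ (∈-++⁺ˡ (subterms-closed (lhs ρ) k∈l i)) (Ground-lookup g i)
    ... | inj₂ k∈r = groundSubterms⁺ ρ∈ (∈-++⁺ʳ (subterms (lhs ρ)) (subterms-closed (rhs ρ) k∈r i)) (Ground-lookup g i)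

    open Flattening R groundSubterms groundSubterms-app groundSubterms-closed

    -- A variable inside an argument that is an application would occur at depth at least 2, so such
    -- an argument is ground and belongs to `groundSubterms`.
    side : ∀ {ρ} → ρ ∈ R → ∀ s → (∀ {k} → k ∈ subterms s → k ∈ ruleSubterms ρ) → ShallowTerm s → Side s
    side ρ∈ (var x)    s⊆ shallow = var
    side ρ∈ (app f ts) s⊆ shallow = app λ i → argument i (lookup ts i) refl
      where
      argument : ∀ i t → lookup ts i ≡ t → Arg t
      argument i (var x)    eq = var
      argument i (app g us) eq = con (groundSubterms⁺ ρ∈
        (s⊆ (there (∈-subterms*⁺ ts i (subst (λ t → app g us ∈ subterms t) (sym eq) (here refl)))))
        λ { _ _ (there j x∈) → contradiction (shallow (there i (subst (OccursAt _ _) (sym eq) (there j x∈)))) λ { (s≤s ()) } })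

    shallow⇒sides : ∀ {ρ} → ρ ∈ R → Side (lhs ρ) × Side (rhs ρ)
    shallow⇒sides {ρ} ρ∈ with shallow-lhs , shallow-rhs ← All.lookup shallow ρ∈ =
      side ρ∈ (lhs ρ) ∈-++⁺ˡ shallow-lhs , side ρ∈ (rhs ρ) (∈-++⁺ʳ (subterms (lhs ρ))) shallow-rhs

theorem3p3 : (F : Signature) (R : TRS F) → Shallow R → Dec (UN⁼ R)
theorem3p3 F R shallow =
  Flattening.Rules.UN⁼? R (groundSubterms R shallow) (groundSubterms-app R shallow)
    (groundSubterms-closed R shallow) (shallow⇒sides R shallow)
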